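{- Let $\mathbf{A} \in \mathsf{CIdInRL}$. Then $\{ 0_x \mid x \in A \} = \{ x \in A \mid x \leq 0 \}$ and $\{ 1_x \mid x \in A \} = A^+$. The algebra $\langle \{ 0_x \mid x \in A \}, \cdot, \vee, 0 \rangle$ (with meet $\cdot$ and join $\vee$) is a distributive sublattice of the lattice $\langle A,\wedge,\vee\rangle$ with maximum element $0$, and it is dually isomorphic to $\langle A^+,\wedge, \vee, 1\rangle = \langle A^+, \wedge, \cdot, 1 \rangle$.
   Context: A commutative idempotent involutive residuated lattice is an algebra $\mathbf{A}=\langle A,\wedge,\vee,\cdot,\to,1,0\rangle$ such that $\langle A,\wedge,\vee\rangle$ is a lattice (with lattice order $\leq$), $\langle A,\cdot,1\rangle$ is a commutative monoid with $x\cdot x=x$ for all $x$, residuation holds ($x\cdot y\leq z \iff y\leq x\to z$), and, writing $-x := x\to 0$, one has $-{ - }x=x$ for all $x$. The class of these algebras is $\mathsf{CIdInRL}$. For $x\in A$ put $1_x := x\vee -x$ and $0_x := x\wedge -x$. The positive cone is $A^+ := \{x\in A\mid 1\leq x\}$. -}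

module Defs where

open import Algebra.Core using (Op₁; Op₂)
open import Algebra.Definitions using (Congruent₂; Involutive)
open import Algebra.Lattice.Bundles using (Lattice; RawLattice)
open import Algebra.Lattice.Structures using (IsLattice)
open import Algebra.Structures using (IsIdempotentCommutativeMonoid)
import Algebra.Lattice.Properties.Lattice as LatticeProperties
open import Data.Product.Base using (Σ; ∃; _,_; proj₁)
open import Function.Base using (_on_)
open import Function.Bundles using (_⇔_)
open import Level using (Level; _⊔_; suc)
open import Relation.Binary.Bundles using (Poset)
open import Relation.Binary.Core using (Rel)
open import Relation.Unary using (Pred)

private
  variable
    a p ℓ : Level

record CIdInRL c ℓ : Set (suc (c ⊔ ℓ)) where
  infixr 8 _·_
  infixr 7 _∧_
  infixr 6 _∨_
  infixr 5 _⇒_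
  infix  4 _≈_
  field
    Carrier : Set c
    _≈_     : Rel Carrier ℓ
    _∧_     : Op₂ Carrier
    _∨_     : Op₂ Carrier
    _·_     : Op₂ Carrier
    _⇒_     : Op₂ Carrier
    1#      : Carrier
    0#      : Carrier

    isLattice : IsLattice _≈_ _∨_ _∧_

  lattice : Lattice c ℓ
  lattice = record { isLattice = isLattice }

  -- The lattice order: x ≤ y unfolds to x ≈ x ∧ y.
  open Poset (LatticeProperties.poset lattice) public using (_≤_)

  infix 9 -_
  -_ : Op₁ Carrier
  - x = x ⇒ 0#

  field
    ·-isIdempotentCommutativeMonoid : IsIdempotentCommutativeMonoid _≈_ _·_ 1#
    ⇒-cong     : Congruent₂ _≈_ _⇒_
    residuated : ∀ x y z → (x · y ≤ z) ⇔ (y ≤ x ⇒ z)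
    involutive : Involutive _≈_ -_

  1[_] : Op₁ Carrier
  1[ x ] = x ∨ - x

  0[_] : Op₁ Carrier
  0[ x ] = x ∧ - x

  -- Membership is up to _≈_, so that these are subsets of the setoid.
  Zeros : Pred Carrier (c ⊔ ℓ)
  Zeros z = ∃ λ x → z ≈ 0[ x ]

  Ones : Pred Carrier (c ⊔ ℓ)
  Ones z = ∃ λ x → z ≈ 1[ x ]

  A⁺ : Pred Carrier ℓ
  A⁺ x = 1# ≤ x

_ClosedUnder_ : {A : Set a} → Pred A p → Op₂ A → Set (a ⊔ p)
P ClosedUnder _∙_ = ∀ {x y} → P x → P y → P (x ∙ y)

restrict : {A : Set a} {P : Pred A p} (_∙_ : Op₂ A) → P ClosedUnder _∙_ → Op₂ (Σ A P)
restrict _∙_ closed (x , px) (y , py) = x ∙ y , closed px py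

-- The algebra ⟨P, _⋏_, _⋎_⟩ on a subset P, with meet _⋏_ and join _⋎_;
-- membership proofs are irrelevant to its equality.
subalgebra : {A : Set a} (_≈_ : Rel A ℓ) (P : Pred A p) (_⋏_ _⋎_ : Op₂ A) →
             P ClosedUnder _⋏_ → P ClosedUnder _⋎_ → RawLattice (a ⊔ p) ℓ
subalgebra {A = A} _≈_ P _⋏_ _⋎_ ⋏-closed ⋎-closed = record
  { Carrier = Σ A P
  ; _≈_     = _≈_ on proj₁
  ; _∧_     = restrict _⋏_ ⋏-closed
  ; _∨_     = restrict _⋎_ ⋎-closed
  }

dual : RawLattice a ℓ → RawLattice a ℓ
dual L = record { Carrier = Carrier ; _≈_ = _≈_ ; _∧_ = _∨_ ; _∨_ = _∧_ }
  where open RawLattice L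

{-# OPTIONS --safe #-}

-- The map x ↦ - x is an antitone involution exchanging 0 and 1, and 0 · 0 ≤ 0
-- yields 0 ≤ 1. Idempotence gives x ∧ y ≤ (x ∧ y) · (x ∧ y) ≤ x · y, so
-- 0[ x ] ≤ x · - x ≤ 0, while x ≤ 0 forces x ≤ 0 ≤ 1 ≤ - x and hence x ≈ 0[ x ].
-- Below 1 the product is also below the meet, so the two agree there and the meet
-- inherits distributivity over ∨ from residuation. Everything about the positive
-- cone is then transported along the involution, except that · is join above 1,
-- which is again idempotence.
module Submission where

open import Defs
open import Algebra.Lattice.Bundles using (Lattice; RawLattice)
open import Algebra.Lattice.Morphism.Structures using (IsLatticeMonomorphism; IsLatticeIsomorphism)
open import Algebra.Lattice.Structures using (IsDistributiveLattice)
open import Data.Product using (Σ; Σ-syntax; ∃; _×_; _,_; proj₁)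
open import Function.Base using (_on_)
open import Relation.Binary.Definitions using (Maximum)
open import Relation.Unary using (_≐_)

open import Algebra.Lattice.Structures.Biased using (isDistributiveLatticeʳʲᵐ)
open import Algebra.Structures using (IsIdempotentCommutativeMonoid)
open import Data.Product using (proj₂)
open import Function.Bundles using (Equivalence)
import Algebra.Lattice.Morphism.LatticeMonomorphism as LatticeMonomorphism
import Algebra.Lattice.Properties.DistributiveLattice as DistributiveLatticeProperties
import Algebra.Lattice.Properties.Lattice as LatticeProperties
import Relation.Binary.Lattice as Order
import Relation.Binary.Lattice.Properties.JoinSemilattice as JoinSemilatticeProperties
import Relation.Binary.Lattice.Properties.MeetSemilattice as MeetSemilatticeProperties
import Relation.Binary.Reasoning.PartialOrder as ≤-Reasoning

module CIdInRLProperties {c ℓ} (A : CIdInRL c ℓ) where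
  open CIdInRL A
  open Order.Lattice (LatticeProperties.∨-∧-orderTheoreticLattice lattice) public
    using (poset; joinSemilattice; meetSemilattice; module Eq; refl; trans; antisym; reflexive;
           x≤x∨y; y≤x∨y; ∨-least; x∧y≤x; x∧y≤y; ∧-greatest)
  open JoinSemilatticeProperties joinSemilattice using (x≤y⇒x∨y≈y; ∨-comm; ∨-monotonic)
  open MeetSemilatticeProperties meetSemilattice using (∧-monotonic)
  open IsIdempotentCommutativeMonoid ·-isIdempotentCommutativeMonoid
    using () renaming (comm to ·-comm; idem to ·-idem; identityˡ to ·-identityˡ;
                       identityʳ to ·-identityʳ; ∙-cong to ·-cong)
  open ≤-Reasoning poset

  residualˡ : ∀ {x y z} → x · y ≤ z → y ≤ x ⇒ z
  residualˡ = Equivalence.to (residuated _ _ _)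

  residualʳ : ∀ {x y z} → y ≤ x ⇒ z → x · y ≤ z
  residualʳ = Equivalence.from (residuated _ _ _)

  ·-monoʳ-≤ : ∀ x {y z} → y ≤ z → x · y ≤ x · z
  -- The inner `residualˡ refl` is the unit of the adjunction, `z ≤ x ⇒ x · z`.
  ·-monoʳ-≤ x y≤z = residualʳ (trans y≤z (residualˡ refl))

  ·-mono-≤ : ∀ {x y u v} → x ≤ y → u ≤ v → x · u ≤ y · v
  ·-mono-≤ {x} {y} {u} {v} x≤y u≤v = begin
    x · u ≤⟨ ·-monoʳ-≤ x u≤v ⟩
    x · v ≈⟨ ·-comm x v ⟩
    v · x ≤⟨ ·-monoʳ-≤ v x≤y ⟩
    v · y ≈⟨ ·-comm v y ⟩
    y · v ∎

  -- Multiplication by `x` is a left adjoint, hence preserves joins. This becomes the distributive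
  -- law of `Zeros`, where the product is the meet.
  ·-distribʳ-∨ : ∀ x y z → (y ∨ z) · x ≈ y · x ∨ z · x
  ·-distribʳ-∨ x y z = antisym
    (begin
      (y ∨ z) · x   ≈⟨ ·-comm (y ∨ z) x ⟩
      x · (y ∨ z)   ≤⟨ residualʳ (∨-least (residualˡ (trans (reflexive (·-comm x y)) (x≤x∨y _ _)))
                                          (residualˡ (trans (reflexive (·-comm x z)) (y≤x∨y _ _)))) ⟩
      y · x ∨ z · x ∎)
    (∨-least (·-mono-≤ (x≤x∨y y z) refl) (·-mono-≤ (y≤x∨y y z) refl))

  -‿cong : ∀ {x y} → x ≈ y → - x ≈ - y
  -‿cong x≈y = ⇒-cong x≈y Eq.refl

  x·-x≤0 : ∀ x → x · - x ≤ 0#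
  x·-x≤0 x = residualʳ refl

  -- Residuation applied to `x · - y ≤ y · - y ≤ 0#`.
  -‿antitone : ∀ {x y} → x ≤ y → - y ≤ - x
  -‿antitone x≤y = residualˡ (trans (·-mono-≤ x≤y refl) (x·-x≤0 _))

  -‿injective : ∀ {x y} → - x ≈ - y → x ≈ y
  -‿injective {x} {y} -x≈-y = begin-equality
    x       ≈⟨ involutive x ⟨
    - (- x) ≈⟨ -‿cong -x≈-y ⟩
    - (- y) ≈⟨ involutive y ⟩
    y       ∎

  -x≤y⇒-y≤x : ∀ {x y} → - x ≤ y → - y ≤ x
  -x≤y⇒-y≤x -x≤y = trans (-‿antitone -x≤y) (reflexive (involutive _))

  y≤-x⇒x≤-y : ∀ {x y} → y ≤ - x → x ≤ - y
  y≤-x⇒x≤-y y≤-x = trans (reflexive (Eq.sym (involutive _))) (-‿antitone y≤-x)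

  -- An antitone involution exchanges meets and joins: bounds on one side of `-` are moved to the
  -- other by `-x≤y⇒-y≤x`.
  deMorgan-∧ : ∀ x y → - (x ∧ y) ≈ - x ∨ - y
  deMorgan-∧ x y = antisym
    (-x≤y⇒-y≤x (∧-greatest (-x≤y⇒-y≤x (x≤x∨y _ _)) (-x≤y⇒-y≤x (y≤x∨y _ _))))
    (∨-least (-‿antitone (x∧y≤x x y)) (-‿antitone (x∧y≤y x y)))

  deMorgan-∨ : ∀ x y → - (x ∨ y) ≈ - x ∧ - y
  deMorgan-∨ x y = antisym
    (∧-greatest (-‿antitone (x≤x∨y x y)) (-‿antitone (y≤x∨y x y)))
    (y≤-x⇒x≤-y (∨-least (y≤-x⇒x≤-y (x∧y≤x _ _)) (y≤-x⇒x≤-y (x∧y≤y _ _))))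

  -1≈0 : - 1# ≈ 0#
  -1≈0 = antisym
    (trans (reflexive (Eq.sym (·-identityˡ (- 1#)))) (x·-x≤0 1#))
    (residualˡ (reflexive (·-identityˡ 0#)))

  -0≈1 : - 0# ≈ 1#
  -0≈1 = Eq.trans (-‿cong (Eq.sym -1≈0)) (involutive 1#)

  0≤1 : 0# ≤ 1#
  0≤1 = trans (residualˡ (reflexive (·-idem 0#))) (reflexive -0≈1)

  x≤0⇒1≤-x : ∀ {x} → x ≤ 0# → 1# ≤ - x
  x≤0⇒1≤-x x≤0 = trans (reflexive (Eq.sym -0≈1)) (-‿antitone x≤0)

  1≤x⇒-x≤0 : ∀ {x} → 1# ≤ x → - x ≤ 0#
  1≤x⇒-x≤0 1≤x = trans (-‿antitone 1≤x) (reflexive -1≈0)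

  ∧≤· : ∀ x y → x ∧ y ≤ x · y
  ∧≤· x y = trans (reflexive (Eq.sym (·-idem _))) (·-mono-≤ (x∧y≤x x y) (x∧y≤y x y))

  -- Dual to `∧≤·`, now with the idempotence of `x ∨ y`: every product lies between the meet and the
  -- join of its factors.
  ·≤∨ : ∀ x y → x · y ≤ x ∨ y
  ·≤∨ x y = trans (·-mono-≤ (x≤x∨y x y) (y≤x∨y x y)) (reflexive (·-idem _))

  -- Raising either factor to the unit bounds the product by the other factor.
  ·≈∧ : ∀ {x y} → x ≤ 1# → y ≤ 1# → x · y ≈ x ∧ y
  ·≈∧ {x} {y} x≤1 y≤1 = antisym
    (∧-greatest (trans (·-mono-≤ refl y≤1) (reflexive (·-identityʳ x)))
                (trans (·-mono-≤ x≤1 refl) (reflexive (·-identityˡ y))))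
    (∧≤· x y)

  ∨≈· : ∀ {x y} → 1# ≤ x → 1# ≤ y → x ∨ y ≈ x · y
  ∨≈· {x} {y} 1≤x 1≤y = antisym
    (∨-least (trans (reflexive (Eq.sym (·-identityʳ x))) (·-mono-≤ refl 1≤y))
             (trans (reflexive (Eq.sym (·-identityˡ y))) (·-mono-≤ 1≤x refl)))
    (·≤∨ x y)

  0[x]≤0 : ∀ x → 0[ x ] ≤ 0#
  0[x]≤0 x = trans (∧≤· x (- x)) (x·-x≤0 x)

  Zeros≐↓0 : Zeros ≐ (λ x → x ≤ 0#)
  Zeros≐↓0 =
    (λ (x , z≈0x) → trans (reflexive z≈0x) (0[x]≤0 x)) ,
    (λ {z} z≤0 → z , antisym (∧-greatest refl (trans z≤0 (trans 0≤1 (x≤0⇒1≤-x z≤0)))) (x∧y≤x _ _))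

  Ones≐A⁺ : Ones ≐ A⁺
  Ones≐A⁺ =
    (λ {z} (x , z≈1x) → begin
      -- Negating `0[ x ]` yields `1[ x ]`, so the bound `0[x]≤0` is reused.
      1#              ≤⟨ x≤0⇒1≤-x (0[x]≤0 x) ⟩
      - (x ∧ - x)     ≈⟨ deMorgan-∧ x (- x) ⟩
      - x ∨ - (- x)   ≤⟨ ∨-monotonic refl (reflexive (involutive x)) ⟩
      - x ∨ x         ≈⟨ ∨-comm (- x) x ⟩
      x ∨ - x         ≈⟨ z≈1x ⟨
      z               ∎) ,
    -- Here `- z ≤ 0# ≤ 1# ≤ z`, so `z` is its own witness.
    (λ {z} 1≤z → z , antisym (x≤x∨y _ _) (∨-least refl (trans (1≤x⇒-x≤0 1≤z) (trans 0≤1 1≤z))))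

  private
    ≤0 : ∀ {z} → Zeros z → z ≤ 0#
    ≤0 = proj₁ Zeros≐↓0

    ≤1 : ∀ {z} → Zeros z → z ≤ 1#
    ≤1 z∈Z = trans (≤0 z∈Z) 0≤1

  -- Closure is an inequality in the down-set of `0#`, carried back through `Zeros≐↓0`, which
  -- supplies the witness.
  Zeros-·-closed : Zeros ClosedUnder _·_
  Zeros-·-closed x∈Z y∈Z =
    proj₂ Zeros≐↓0 (trans (·-mono-≤ (≤0 x∈Z) (≤0 y∈Z)) (reflexive (·-idem 0#)))

  Zeros-∨-closed : Zeros ClosedUnder _∨_
  Zeros-∨-closed x∈Z y∈Z = proj₂ Zeros≐↓0 (∨-least (≤0 x∈Z) (≤0 y∈Z))

  0∈Zeros : Zeros 0#
  0∈Zeros = proj₂ Zeros≐↓0 refl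

  A⁺-∧-closed : A⁺ ClosedUnder _∧_
  A⁺-∧-closed = ∧-greatest

  A⁺-∨-closed : A⁺ ClosedUnder _∨_
  A⁺-∨-closed 1≤x _ = trans 1≤x (x≤x∨y _ _)

  A⁺-·-closed : A⁺ ClosedUnder _·_
  A⁺-·-closed 1≤x 1≤y = trans (reflexive (Eq.sym (·-idem 1#))) (·-mono-≤ 1≤x 1≤y)

  Zeros-rawLattice : RawLattice _ _
  Zeros-rawLattice = subalgebra _≈_ Zeros _·_ _∨_ Zeros-·-closed Zeros-∨-closed

  A⁺-rawLattice : RawLattice _ _
  A⁺-rawLattice = subalgebra _≈_ A⁺ _∧_ _∨_ A⁺-∧-closed A⁺-∨-closed

  open RawLattice Zeros-rawLattice using ()
    renaming (Carrier to Z; _≈_ to _≈ᶻ_; _∨_ to _∨ᶻ_; _∧_ to _∧ᶻ_)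

  -- The content is that `_·_` agrees with the ambient meet, because `0# ≤ 1#`. The lattice laws of
  -- `Zeros` are then reflected from those of the ambient lattice along this embedding.
  Zeros-inclusion : IsLatticeMonomorphism Zeros-rawLattice (Lattice.rawLattice lattice) proj₁
  Zeros-inclusion = record
    { isLatticeHomomorphism = record
      { isRelHomomorphism = record { cong = λ x≈y → x≈y }
      ; ∧-homo = λ (_ , x∈Z) (_ , y∈Z) → ·≈∧ (≤1 x∈Z) (≤1 y∈Z)
      ; ∨-homo = λ _ _ → Eq.refl
      }
    ; injective = λ x≈y → x≈y
    }

  Zeros-lattice : Lattice _ _
  Zeros-lattice = record { isLattice = LatticeMonomorphism.isLattice Zeros-inclusion isLattice }

  -- Only the law ∧ over ∨ is available from residuation, so the biased constructor is
  -- applied to the dual lattice.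
  Zeros-isDistributiveLattice : IsDistributiveLattice _≈ᶻ_ _∨ᶻ_ _∧ᶻ_
  Zeros-isDistributiveLattice =
    DistributiveLatticeProperties.∧-∨-isDistributiveLattice (record
      { isDistributiveLattice = isDistributiveLatticeʳʲᵐ (record
        { isLattice    = LatticeProperties.∧-∨-isLattice Zeros-lattice
        ; ∨-distribʳ-∧ = λ (x , _) (y , _) (z , _) → ·-distribʳ-∨ x y z
        })
      })

  negate : Z → RawLattice.Carrier A⁺-rawLattice
  negate (x , x∈Z) = - x , x≤0⇒1≤-x (≤0 x∈Z)

  negate-isLatticeIsomorphism : IsLatticeIsomorphism Zeros-rawLattice (dual A⁺-rawLattice) negate
  negate-isLatticeIsomorphism = record
    { isLatticeMonomorphism = record
      { isLatticeHomomorphism = record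
        { isRelHomomorphism = record { cong = -‿cong }
        -- The meet of the dual is `_∨_`; the product is rewritten as a meet so that De Morgan
        -- applies.
        ; ∧-homo = λ (x , x∈Z) (y , y∈Z) →
            Eq.trans (-‿cong (·≈∧ (≤1 x∈Z) (≤1 y∈Z))) (deMorgan-∧ x y)
        ; ∨-homo = λ (x , _) (y , _) → deMorgan-∨ x y
        }
      ; injective = -‿injective
      }
    -- Negation is its own inverse, so the preimage of `y` is `- y`, which lies below `0#`.
    ; surjective = λ (y , 1≤y) →
        (- y , proj₂ Zeros≐↓0 (1≤x⇒-x≤0 1≤y)) ,
        λ z≈-y → Eq.trans (-‿cong z≈-y) (involutive y)
    }

theorem3p5 : ∀ {c ℓ} (A : CIdInRL c ℓ) → let open CIdInRL A in
  (Zeros ≐ (λ x → x ≤ 0#)) ×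
  (Ones ≐ A⁺) ×
  (Σ[ Z· ∈ Zeros ClosedUnder _·_ ]
   Σ[ Z∨ ∈ Zeros ClosedUnder _∨_ ]
   Σ[ Z0 ∈ Zeros 0# ]
   Σ[ P∧ ∈ A⁺ ClosedUnder _∧_ ]
   Σ[ P∨ ∈ A⁺ ClosedUnder _∨_ ]
   Σ[ P· ∈ A⁺ ClosedUnder _·_ ]
   Σ[ P1 ∈ A⁺ 1# ]
     (let Z  = subalgebra _≈_ Zeros _·_ _∨_ Z· Z∨
          P  = subalgebra _≈_ A⁺ _∧_ _∨_ P∧ P∨
          P′ = subalgebra _≈_ A⁺ _∧_ _·_ P∧ P·
          0Z : RawLattice.Carrier Z
          0Z = 0# , Z0
          1P : RawLattice.Carrier P
          1P = 1# , P1
      in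
      IsDistributiveLattice (RawLattice._≈_ Z) (RawLattice._∨_ Z) (RawLattice._∧_ Z) ×
      IsLatticeMonomorphism Z (Lattice.rawLattice lattice) proj₁ ×
      Maximum (_≤_ on proj₁) 0Z ×
      (∀ x y → RawLattice._≈_ P (RawLattice._∨_ P x y) (RawLattice._∨_ P′ x y)) ×
      (∃ λ (f : RawLattice.Carrier Z → RawLattice.Carrier P) →
         IsLatticeIsomorphism Z (dual P) f ×
         RawLattice._≈_ P (f 0Z) 1P)))
theorem3p5 A =
  Zeros≐↓0 , Ones≐A⁺ ,
  Zeros-·-closed , Zeros-∨-closed , 0∈Zeros ,
  A⁺-∧-closed , A⁺-∨-closed , A⁺-·-closed , refl ,
  Zeros-isDistributiveLattice ,
  Zeros-inclusion ,
  (λ (_ , x∈Z) → proj₁ Zeros≐↓0 x∈Z) ,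
  (λ (_ , 1≤x) (_ , 1≤y) → ∨≈· 1≤x 1≤y) ,
  negate , negate-isLatticeIsomorphism , -0≈1
  where open CIdInRLProperties A
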